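{- Let $G$ be a tree on $n\ge 4$ vertices, with complement $\overline{G}$. If $G$ is not $K_{1,3}$ or $K_{1,4}$, then $$\gamma_P(G)\cdot\gamma_P(\overline{G})\le\left\lfloor\frac{n}{3}\right\rfloor,$$ and this bound is attained for arbitrarily large $n$.
   Context: All graphs are finite, simple, undirected, with nonempty vertex set. $N(v)$ is the set of neighbors of $v$, $N[v]=N(v)\cup\{v\}$, and $N[S]=\bigcup_{v\in S}N[v]$. For $S\subseteq V(G)$, define $PD(S)$ by: (1) start with $PD(S):=N[S]$; (2) while there exists $v\in PD(S)$ with $|N(v)\setminus PD(S)|=1$, set $PD(S):=PD(S)\cup N(v)$. $S$ is a power dominating set if $PD(S)=V(G)$ at the end of the process. The power domination number $\gamma_P(G)$ is the minimum cardinality of a power dominating set of $G$. $K_{p,q}$ is the complete bipartite graph with partite sets of cardinality $p$ and $q$. -}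

module Defs where

open import Data.Bool.Base using (Bool; true; false)
import Data.Bool.Properties as Bool
open import Data.Fin.Base using (Fin; splitAt)
import Data.Fin.Properties as Fin
open import Data.Fin.Subset
  using (Subset; _∈_; _⊆_; _⊃_; _∪_; _─_; ⁅_⁆; ⊤; ∣_∣)
open import Data.Fin.Subset.Properties
  using (_∈?_; anySubset?; p⊆p∪q; q⊆p∪q; p⊆q⇒∣p∣≤∣q∣; p─q⊆p; x∈⁅x⁆
        ; x∈p∧x∉q⇒x∈p─q; x∈p∪q⁻; ⊆-refl; ⊆-trans
        ; ⊆-antisym; ⊆-max; ∈⊤)
open import Data.Fin.Subset.Induction using (⊃-wellFounded)
open import Data.List.Base using (List; _∷_; _∷ʳ_; length)
open import Data.List.Relation.Unary.Linked using (Linked)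
open import Data.List.Relation.Unary.Unique.Propositional using (Unique)
open import Data.Nat.Base using (ℕ; _+_; _≤_; _<_; z≤n; s≤s)
import Data.Nat.Properties as ℕ
open import Data.Nat.Induction using (<-wellFounded)
open import Data.Product.Base using (∃; ∃-syntax; _×_; _,_; proj₁; proj₂)
open import Data.Sum.Base using (inj₁; inj₂; [_,_])
open import Data.Vec.Base using (_∷_; here; there; tabulate)
open import Data.Vec.Properties using (lookup∘tabulate; lookup⇒[]=; []=⇒lookup; ≡-dec)
open import Function.Base using (const; _∘_)
open import Function.Bundles using (_↔_; _⇔_; Inverse)
open import Induction.WellFounded using (Acc; acc)
open import Level using (0ℓ)
open import Relation.Binary.Core using (Rel)
open import Relation.Binary.Construct.Closure.ReflexiveTransitive using (Star; ε; _◅_)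
open import Relation.Binary.Definitions using (Decidable; Symmetric; Irreflexive)
open import Relation.Binary.PropositionalEquality
  using (_≡_; _≢_; refl; sym; trans; ≢-sym)
open import Relation.Nullary.Decidable
  using (Dec; yes; no; does; dec-true; _×-dec_; ¬?)
open import Relation.Nullary.Negation using (¬_; contradiction)
import Relation.Unary as Unary

record Graph (n : ℕ) : Set₁ where
  field
    Adj    : Rel (Fin n) 0ℓ
    adj?   : Decidable Adj
    symm   : Symmetric Adj
    irrefl : Irreflexive _≡_ Adj

complement : ∀ {n} → Graph n → Graph n
complement G = record
  { Adj    = λ u v → u ≢ v × ¬ Adj u v
  ; adj?   = λ u v → ¬? (u Fin.≟ v) ×-dec ¬? (adj? u v)
  ; symm   = λ (u≢v , ¬uv) → ≢-sym u≢v , ¬uv ∘ symm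
  ; irrefl = λ u≡v (u≢v , _) → u≢v u≡v
  } where open Graph G

-- The first p vertices form one partite set, the last q the other.
K : (p q : ℕ) → Graph (p + q)
K p q = record
  { Adj    = λ u v → side u ≢ side v
  ; adj?   = λ u v → ¬? (side u Bool.≟ side v)
  ; symm   = ≢-sym
  ; irrefl = λ { refl s≢s → s≢s refl }
  } where
  side : Fin (p + q) → Bool
  side u = [ const true , const false ] (splitAt p u)

infix 4 _≅_

record _≅_ {m n} (G : Graph m) (H : Graph n) : Set where
  field
    bijection : Fin m ↔ Fin n
  open Inverse bijection public using (to; from)
  field
    preserves : ∀ u v → Graph.Adj G u v ⇔ Graph.Adj H (to u) (to v)

Connected : ∀ {n} → Graph n → Set
Connected {n} G = (u v : Fin n) → Star (Graph.Adj G) u v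

-- The cycle visits first, then rest in order, and returns to first.
record Cycle {n} (G : Graph n) : Set where
  field
    first    : Fin n
    rest     : List (Fin n)
    long     : 3 ≤ length (first ∷ rest)
    distinct : Unique (first ∷ rest)
    closed   : Linked (Graph.Adj G) ((first ∷ rest) ∷ʳ first)

IsTree : ∀ {n} → Graph n → Set
IsTree G = Connected G × ¬ Cycle G

module _ {n} {P : Unary.Pred (Fin n) 0ℓ} (P? : Unary.Decidable P) where

  ⟪_⟫ : Subset n
  ⟪_⟫ = tabulate (does ∘ P?)

  ∈⟪⟫⁺ : ∀ {x} → P x → x ∈ ⟪_⟫
  ∈⟪⟫⁺ {x} px = lookup⇒[]= x _ (trans (lookup∘tabulate (does ∘ P?) x) (dec-true (P? x) px))

  ∈⟪⟫⁻ : ∀ {x} → x ∈ ⟪_⟫ → P x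
  ∈⟪⟫⁻ {x} x∈ with P? x | trans (sym (lookup∘tabulate (does ∘ P?) x)) ([]=⇒lookup x∈)
  ... | yes px | _  = px
  ... | no _   | ()

x∈p─q⇒x∉q : ∀ {n} (p q : Subset n) {x} → x ∈ p ─ q → ¬ x ∈ q
x∈p─q⇒x∉q (_ ∷ p) (true  ∷ q) (there x∈) (there x∈q) = x∈p─q⇒x∉q p q x∈ x∈q
x∈p─q⇒x∉q (_ ∷ p) (false ∷ q) (there x∈) (there x∈q) = x∈p─q⇒x∉q p q x∈ x∈q

─-antitoneʳ : ∀ {n} {q r : Subset n} (p : Subset n) → q ⊆ r → ∣ p ─ r ∣ ≤ ∣ p ─ q ∣
─-antitoneʳ {q = q} {r} p q⊆r = p⊆q⇒∣p∣≤∣q∣ λ x∈p─r →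
  x∈p∧x∉q⇒x∈p─q (p─q⊆p p r x∈p─r) (x∈p─q⇒x∉q p r x∈p─r ∘ q⊆r)

x∈p⇒1≤∣p∣ : ∀ {n x} {p : Subset n} → x ∈ p → 1 ≤ ∣ p ∣
x∈p⇒1≤∣p∣ here = s≤s z≤n
x∈p⇒1≤∣p∣ (there {y = true}  _)  = s≤s z≤n
x∈p⇒1≤∣p∣ (there {y = false} x∈) = x∈p⇒1≤∣p∣ x∈

1≤∣p∣⇒∃x∈p : ∀ {n} (p : Subset n) → 1 ≤ ∣ p ∣ → ∃[ x ] x ∈ p
1≤∣p∣⇒∃x∈p (true  ∷ p) _ = _ , here
1≤∣p∣⇒∃x∈p (false ∷ p) h with 1≤∣p∣⇒∃x∈p p h
... | _ , x∈ = _ , there x∈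

∣p─q∣≡0⇒p⊆q : ∀ {n} (p q : Subset n) → ∣ p ─ q ∣ ≡ 0 → p ⊆ q
∣p─q∣≡0⇒p⊆q p q eq {x} x∈p with x ∈? q
... | yes x∈q = x∈q
... | no  x∉q = contradiction (x∈p⇒1≤∣p∣ (x∈p∧x∉q⇒x∈p─q x∈p x∉q))
                  (λ 1≤ → ℕ.<⇒≢ 1≤ (sym eq))

module _ {n} (G : Graph n) where
  open Graph G

  N : Fin n → Subset n
  N v = ⟪ adj? v ⟫

  N[_] : Fin n → Subset n
  N[ v ] = N v ∪ ⁅ v ⁆

  inN[_]? : ∀ S w → Dec (∃[ v ] v ∈ S × w ∈ N[ v ])
  inN[ S ]? w = Fin.any? λ v → v ∈? S ×-dec w ∈? N[ v ]

  N[_]ₛ : Subset n → Subset n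
  N[ S ]ₛ = ⟪ inN[ S ]? ⟫

  Forces : Subset n → Fin n → Set
  Forces P v = v ∈ P × ∣ N v ─ P ∣ ≡ 1

  forces? : ∀ P v → Dec (Forces P v)
  forces? P v = v ∈? P ×-dec ∣ N v ─ P ∣ ℕ.≟ 1

  infix 4 _⟶_ _⟶*_

  _⟶_ : Rel (Subset n) 0ℓ
  P ⟶ Q = ∃[ v ] Forces P v × Q ≡ P ∪ N v

  _⟶*_ : Rel (Subset n) 0ℓ
  _⟶*_ = Star _⟶_

  Terminal : Subset n → Set
  Terminal P = ∀ v → ¬ Forces P v

  force-⊃ : ∀ {P v} → Forces P v → (P ∪ N v) ⊃ P
  force-⊃ {P} {v} (_ , ∣─∣≡1) with 1≤∣p∣⇒∃x∈p (N v ─ P) (ℕ.≤-reflexive (sym ∣─∣≡1))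
  ... | x , x∈ =
    p⊆p∪q (N v) , x , q⊆p∪q P (N v) (p─q⊆p (N v) P x∈) , x∈p─q⇒x∉q (N v) P x∈

  run : ∀ P → Acc _⊃_ P → ∃[ Q ] (P ⟶* Q) × Terminal Q
  run P (acc rec) with Fin.any? (forces? P)
  ... | no none       = P , ε , λ v f → none (v , f)
  ... | yes (v , frc) with run (P ∪ N v) (rec (force-⊃ frc))
  ...   | Q , steps , end = Q , (v , frc , refl) ◅ steps , end

  PD : Subset n → Subset n
  PD S = proj₁ (run N[ S ]ₛ (⊃-wellFounded _))

  PD-reachable : ∀ S → N[ S ]ₛ ⟶* PD S
  PD-reachable S = proj₁ (proj₂ (run N[ S ]ₛ (⊃-wellFounded _)))

  PD-terminal : ∀ S → Terminal (PD S)
  PD-terminal S = proj₂ (proj₂ (run N[ S ]ₛ (⊃-wellFounded _)))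

  ⟶*-⊆-terminal : ∀ {P Q R} → P ⟶* Q → P ⊆ R → Terminal R → Q ⊆ R
  ⟶*-⊆-terminal ε P⊆R _ = P⊆R
  ⟶*-⊆-terminal {P} {R = R} ((v , (v∈P , ∣─∣≡1) , refl) ◅ steps) P⊆R end =
    ⟶*-⊆-terminal steps P∪Nv⊆R end
    where
    ∣Nv─R∣≡0 : ∣ N v ─ R ∣ ≡ 0
    ∣Nv─R∣≡0 = ℕ.n<1⇒n≡0 (ℕ.≤∧≢⇒<
      (ℕ.≤-trans (─-antitoneʳ (N v) P⊆R) (ℕ.≤-reflexive ∣─∣≡1))
      (λ ≡1 → end v (P⊆R v∈P , ≡1)))

    P∪Nv⊆R : (P ∪ N v) ⊆ R
    P∪Nv⊆R x∈ with x∈p∪q⁻ P (N v) x∈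
    ... | inj₁ x∈P  = P⊆R x∈P
    ... | inj₂ x∈Nv = ∣p─q∣≡0⇒p⊆q (N v) R ∣Nv─R∣≡0 x∈Nv

  ⟶*-⊆ : ∀ {P Q} → P ⟶* Q → P ⊆ Q
  ⟶*-⊆ ε = ⊆-refl
  ⟶*-⊆ ((v , _ , refl) ◅ steps) = ⊆-trans (p⊆p∪q (N v)) (⟶*-⊆ steps)

  -- The choice of forcing vertices made in run does not affect the outcome.
  PD-unique : ∀ {S P} → N[ S ]ₛ ⟶* P → Terminal P → P ≡ PD S
  PD-unique {S} steps end = ⊆-antisym
    (⟶*-⊆-terminal steps (⟶*-⊆ (PD-reachable S)) (PD-terminal S))
    (⟶*-⊆-terminal (PD-reachable S) (⟶*-⊆ steps) end)

  PowerDominating : Subset n → Set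
  PowerDominating S = PD S ≡ ⊤

  powerDominating? : ∀ S → Dec (PowerDominating S)
  powerDominating? S = ≡-dec Bool._≟_ (PD S) ⊤

  ⊤-powerDominating : PowerDominating ⊤
  ⊤-powerDominating = ⊆-antisym (⊆-max _) (⊆-trans ⊤⊆N[⊤] (⟶*-⊆ (PD-reachable ⊤)))
    where
    ⊤⊆N[⊤] : ⊤ ⊆ N[ ⊤ ]ₛ
    ⊤⊆N[⊤] {x} _ = ∈⟪⟫⁺ inN[ ⊤ ]? (x , ∈⊤ , q⊆p∪q (N x) ⁅ x ⁆ (x∈⁅x⁆ x))

  IsMinimumPowerDominating : Subset n → Set
  IsMinimumPowerDominating S =
    PowerDominating S × (∀ T → PowerDominating T → ∣ S ∣ ≤ ∣ T ∣)

  minimise : ∀ S → PowerDominating S → Acc _<_ ∣ S ∣ → ∃ IsMinimumPowerDominating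
  minimise S pd (acc rec)
    with anySubset? (λ T → powerDominating? T ×-dec ∣ T ∣ ℕ.<? ∣ S ∣)
  ... | yes (T , pd′ , ∣T∣<∣S∣) = minimise T pd′ (rec ∣T∣<∣S∣)
  ... | no none = S , pd , λ T pd′ → ℕ.≮⇒≥ (λ ∣T∣<∣S∣ → none (T , pd′ , ∣T∣<∣S∣))

  minimumPowerDominating : ∃ IsMinimumPowerDominating
  minimumPowerDominating = minimise ⊤ ⊤-powerDominating (<-wellFounded _)

  γP : ℕ
  γP = ∣ proj₁ minimumPowerDominating ∣

{-# OPTIONS --safe #-}

-- Let S be a power dominating set of non-leaves in which no vertex can be dropped and no exchange
-- v ↦ u lowers the number of vertices without a neighbour in S. Then each v ∈ S has two private
-- neighbours outside S: if it had at most one, the other neighbours of v would be dominated by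
-- S - v, so as soon as v is dominated it forces the last one, and v could be dropped or exchanged
-- for a neighbour. Hence 3 ∣S∣ ≤ n. In the complement, a leaf v with neighbour u dominates all but
-- u, and u is forced unless it is adjacent to every other vertex, i.e. unless G is a star; for a
-- star the product is at most 2 ≤ n / 3 once n ≥ 6. Equality holds when each of n / 3 hubs carries
-- two leaves, since a power dominating set must meet every hub together with its leaves.
module Submission where

open import Defs
open import Data.Nat using (ℕ; _*_; _/_; _≤_)
open import Data.Product using (_×_; ∃-syntax)
open import Relation.Nullary using (¬_)
open import Relation.Binary.PropositionalEquality using (_≡_)

open import Data.Bool.Base using (true; false)
import Data.Empty as Empty
open import Data.Fin.Base using (Fin; zero; suc; combine; remQuot; fromℕ<)
import Data.Fin.Properties as Fin
open import Data.Fin.Permutation using (transpose)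
open import Data.Fin.Subset using (Subset; _∈_; _∉_; _⊆_; _∪_; _─_; _-_; ⁅_⁆; ⊤; ⊥; ∣_∣)
open import Data.Fin.Subset.Properties
  using (_∈?_; p⊆p∪q; q⊆p∪q; p─q⊆p; x∈⁅x⁆; x∈⁅y⁆⇒x≡y; x∈p∪q⁻; ∣⁅x⁆∣≡1; ⊆-antisym; ⊆-max; ∈⊤; ∉⊥
        ; ∣p∣≤n; ∪-identityʳ; x∈p∧x∉q⇒x∈p─q; x∈p∧x≢y⇒x∈p-y; x∈p⇒∣p-x∣<∣p∣; p⊂q⇒∣p∣<∣q∣)
open import Data.List.Base using (List; []; _∷_; _++_; _∷ʳ_; length; lookup)
open import Data.List.Membership.Propositional using () renaming (_∈_ to _∈ₗ_)
open import Data.List.Membership.Propositional.Properties using (∈-∃++; ∈-lookup)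
open import Data.List.Relation.Unary.All as All using ([]; _∷_)
import Data.List.Relation.Unary.All.Properties as All
open import Data.List.Relation.Unary.AllPairs using ([]; _∷_)
import Data.List.Relation.Unary.AllPairs.Properties as AllPairs
open import Data.List.Relation.Unary.Any as Any using (here; there)
open import Data.List.Relation.Unary.Linked using (Linked; [-]; _∷_)
open import Data.List.Relation.Unary.Unique.Propositional using (Unique)
open import Data.Nat.Base using (zero; suc; _+_; _<_; z≤n; s≤s; s≤s⁻¹)
open import Data.Nat.DivMod using (m*n/n≡m; /-monoˡ-≤)
import Data.Nat.Properties as ℕ
open import Data.Product.Base using (∃; _,_; proj₁; proj₂; uncurry)
open import Data.Sum.Base using (_⊎_; inj₁; inj₂; swap)
open import Data.Vec.Base using (_∷_; here; there)
open import Function.Base using (_∘_)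
open import Function.Bundles using (mk⇔; Inverse)
open import Function.Definitions using (Injective)
open import Relation.Binary.Construct.Closure.ReflexiveTransitive using (Star; ε; _◅_; _◅◅_; reverse)
open import Relation.Binary.PropositionalEquality
  using (_≢_; refl; sym; trans; cong; subst; ≢-sym)
open import Relation.Nullary.Decidable
  using (Dec; yes; no; _×-dec_; _→-dec_; _⊎-dec_; ¬?; dec-true; decidable-stable)
open import Relation.Nullary.Negation using (contradiction)

-- Enumerating and counting finite subsets.

enumerate : ∀ {n} (p : Subset n) → Fin ∣ p ∣ → Fin n
enumerate (true  ∷ p) zero    = zero
enumerate (true  ∷ p) (suc i) = suc (enumerate p i)
enumerate (false ∷ p) i       = suc (enumerate p i)

enumerate-∈ : ∀ {n} (p : Subset n) i → enumerate p i ∈ p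
enumerate-∈ (true  ∷ p) zero    = here
enumerate-∈ (true  ∷ p) (suc i) = there (enumerate-∈ p i)
enumerate-∈ (false ∷ p) i       = there (enumerate-∈ p i)

enumerate-injective : ∀ {n} (p : Subset n) → Injective _≡_ _≡_ (enumerate p)
enumerate-injective (true  ∷ p) {zero}  {zero}  _  = refl
enumerate-injective (true  ∷ p) {suc i} {suc j} eq =
  cong suc (enumerate-injective p (Fin.suc-injective eq))
enumerate-injective (false ∷ p) eq = enumerate-injective p (Fin.suc-injective eq)

index : ∀ {n} {p : Subset n} {x} → x ∈ p → Fin ∣ p ∣
index here                      = zero
index (there {y = true}  x∈p) = suc (index x∈p)
index (there {y = false} x∈p) = index x∈p

enumerate-index : ∀ {n} {p : Subset n} {x} (x∈p : x ∈ p) → enumerate p (index x∈p) ≡ x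
enumerate-index here                      = refl
enumerate-index (there {y = true}  x∈p) = cong suc (enumerate-index x∈p)
enumerate-index (there {y = false} x∈p) = cong suc (enumerate-index x∈p)

index-injective : ∀ {n} {p : Subset n} {x y} (x∈p : x ∈ p) (y∈p : y ∈ p) →
                  index x∈p ≡ index y∈p → x ≡ y
index-injective {p = p} x∈p y∈p eq =
  trans (sym (enumerate-index x∈p)) (trans (cong (enumerate p) eq) (enumerate-index y∈p))

injection⇒≤∣p∣ : ∀ {k n} {p : Subset n} {f : Fin k → Fin n} →
                 Injective _≡_ _≡_ f → (∀ i → f i ∈ p) → k ≤ ∣ p ∣
injection⇒≤∣p∣ inj f∈p = Fin.injective⇒≤ λ eq → inj (index-injective (f∈p _) (f∈p _) eq)

∃-distinct : ∀ {n} → 2 ≤ n → ∀ (x : Fin n) → ∃[ y ] x ≢ y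
∃-distinct (s≤s (s≤s _)) zero    = suc zero , λ ()
∃-distinct (s≤s (s≤s _)) (suc _) = zero , λ ()

∣p∣≡1⇒x≡y : ∀ {n} {p : Subset n} {x y} → ∣ p ∣ ≡ 1 → x ∈ p → y ∈ p → x ≡ y
∣p∣≡1⇒x≡y {p = p} ∣p∣≡1 x∈p y∈p = index-injective x∈p y∈p (all-equal ∣p∣≡1 _ _)
  where
  all-equal : ∀ {k} → k ≡ 1 → (i j : Fin k) → i ≡ j
  all-equal refl zero zero = refl

x∉p-x : ∀ {n} (p : Subset n) x → x ∉ p - x
x∉p-x p x x∈p-x = x∈p─q⇒x∉q p ⁅ x ⁆ x∈p-x (x∈⁅x⁆ x)

∣p∪⁅x⁆∣≤1+∣p∣ : ∀ {n} (p : Subset n) x → ∣ p ∪ ⁅ x ⁆ ∣ ≤ suc ∣ p ∣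
∣p∪⁅x⁆∣≤1+∣p∣ (true  ∷ p) zero    rewrite ∪-identityʳ p = s≤s (ℕ.n≤1+n _)
∣p∪⁅x⁆∣≤1+∣p∣ (false ∷ p) zero    rewrite ∪-identityʳ p = ℕ.≤-refl
∣p∪⁅x⁆∣≤1+∣p∣ (true  ∷ p) (suc x) = s≤s (∣p∪⁅x⁆∣≤1+∣p∣ p x)
∣p∪⁅x⁆∣≤1+∣p∣ (false ∷ p) (suc x) = ∣p∪⁅x⁆∣≤1+∣p∣ p x

-- Power domination through closed sets; leaves and branching vertices.

module _ {n} (G : Graph n) where
  open Graph G

  ∈N⁺ : ∀ {v x} → Adj v x → x ∈ N G v
  ∈N⁺ = ∈⟪⟫⁺ (adj? _)

  ∈N⁻ : ∀ {v x} → x ∈ N G v → Adj v x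
  ∈N⁻ = ∈⟪⟫⁻ (adj? _)

  Closed : Subset n → Set
  Closed R = ∀ {v x} → v ∈ R → Adj v x → (∀ {y} → Adj v y → y ≢ x → y ∈ R) → x ∈ R

  Covers : Subset n → Subset n → Set
  Covers R S = ∀ {v} → v ∈ S → v ∈ R × (∀ {y} → Adj v y → y ∈ R)

  -- `PD G S` is the least closed set that contains `N[ S ]ₛ`, so this is power domination with the
  -- forcing sequence eliminated.
  Spans : Subset n → Set
  Spans S = ∀ R → Covers R S → Closed R → ∀ x → x ∈ R

  -- If `x` were missing from `R`, it would be the only element of `N G v ─ R`, and `v` would force
  -- it.
  Terminal⇒Closed : ∀ {R} → Terminal G R → Closed R
  Terminal⇒Closed {R} end {v} {x} v∈R vx others with x ∈? R
  ... | yes x∈R = x∈R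
  ... | no  x∉R = contradiction (v∈R , trans (cong ∣_∣ N─R≡⁅x⁆) (∣⁅x⁆∣≡1 x)) (end v)
    where
    only-x : ∀ {y} → y ∈ N G v ─ R → y ∈ ⁅ x ⁆
    only-x {y} y∈ with y Fin.≟ x
    ... | yes refl = x∈⁅x⁆ x
    ... | no  y≢x  = contradiction (others (∈N⁻ (p─q⊆p (N G v) R y∈)) y≢x)
                       (x∈p─q⇒x∉q (N G v) R y∈)

    N─R≡⁅x⁆ : N G v ─ R ≡ ⁅ x ⁆
    N─R≡⁅x⁆ = ⊆-antisym only-x λ z∈ →
      subst (_∈ N G v ─ R) (sym (x∈⁅y⁆⇒x≡y x z∈)) (x∈p∧x∉q⇒x∈p─q (∈N⁺ vx) x∉R)

  Closed⇒Terminal : ∀ {R} → Closed R → Terminal G R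
  Closed⇒Terminal {R} closed v (v∈R , ∣─∣≡1)
    with x , x∈ ← 1≤∣p∣⇒∃x∈p (N G v ─ R) (ℕ.≤-reflexive (sym ∣─∣≡1)) =
    x∈p─q⇒x∉q (N G v) R x∈ (closed v∈R (∈N⁻ (p─q⊆p (N G v) R x∈)) others)
    where
    others : ∀ {y} → Adj v y → y ≢ x → y ∈ R
    others {y} vy y≢x = decidable-stable (y ∈? R) λ y∉R →
      y≢x (∣p∣≡1⇒x≡y ∣─∣≡1 (x∈p∧x∉q⇒x∈p─q (∈N⁺ vy) y∉R) x∈)

  -- A closed set is terminal, and a terminal set containing `N[ S ]ₛ` contains everything forced
  -- from it, hence `PD G S`.
  PowerDominating⇒Spans : ∀ {S} → PowerDominating G S → Spans S
  PowerDominating⇒Spans {S} pd R covers closed x =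
    ⟶*-⊆-terminal G (PD-reachable G S) N[S]⊆R (Closed⇒Terminal closed)
      (subst (x ∈_) (sym pd) ∈⊤)
    where
    N[S]⊆R : N[_]ₛ G S ⊆ R
    N[S]⊆R w∈ with v , v∈S , w∈N[v] ← ∈⟪⟫⁻ (inN[_]? G S) w∈ with x∈p∪q⁻ (N G v) ⁅ v ⁆ w∈N[v]
    ... | inj₁ w∈N = proj₂ (covers v∈S) (∈N⁻ w∈N)
    ... | inj₂ w∈v rewrite x∈⁅y⁆⇒x≡y v w∈v = proj₁ (covers v∈S)

  Spans⇒PowerDominating : ∀ {S} → Spans S → PowerDominating G S
  Spans⇒PowerDominating {S} spans = ⊆-antisym (⊆-max _) λ {x} _ →
    spans (PD G S) covers (Terminal⇒Closed (PD-terminal G S)) x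
    where
    N[S]⊆PD : ∀ {v w} → v ∈ S → w ∈ N[_] G v → w ∈ PD G S
    N[S]⊆PD v∈S w∈ = ⟶*-⊆ G (PD-reachable G S) (∈⟪⟫⁺ (inN[_]? G S) (_ , v∈S , w∈))

    covers : Covers (PD G S) S
    covers {v} v∈S = N[S]⊆PD v∈S (q⊆p∪q (N G v) ⁅ v ⁆ (x∈⁅x⁆ v))
                   , λ vy → N[S]⊆PD v∈S (p⊆p∪q ⁅ v ⁆ (∈N⁺ vy))

  γP≤ : ∀ {S} → Spans S → γP G ≤ ∣ S ∣
  γP≤ spans = proj₂ (proj₂ (minimumPowerDominating G)) _ (Spans⇒PowerDominating spans)

  ≤γP : ∀ {k} → (∀ {S} → Spans S → k ≤ ∣ S ∣) → k ≤ γP G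
  ≤γP bound = bound (PowerDominating⇒Spans (proj₁ (proj₂ (minimumPowerDominating G))))

  -- Degree at most one and degree at least two. In `Leaf` the vertex `u` may fail to be adjacent to
  -- `v`, so isolated vertices count; `Branching` supplies a neighbour that avoids any given vertex.
  Leaf Branching : Fin n → Set
  Leaf v      = ∃[ u ] (∀ y → Adj v y → y ≡ u)
  Branching v = ∀ u → ∃[ w ] Adj v w × w ≢ u

  leaf? : ∀ v → Dec (Leaf v)
  leaf? v = Fin.any? λ u → Fin.all? λ y → adj? v y →-dec (y Fin.≟ u)

  ¬Leaf⇒Branching : ∀ {v} → ¬ Leaf v → Branching v
  ¬Leaf⇒Branching {v} ¬leaf u with Fin.any? (λ w → adj? v w ×-dec ¬? (w Fin.≟ u))
  ... | yes found = found
  ... | no  none  = contradiction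
    (u , λ y vy → decidable-stable (y Fin.≟ u) λ y≢u → none (y , vy , y≢u)) ¬leaf

  Branching⇒¬Leaf : ∀ {v} → Branching v → ¬ Leaf v
  Branching⇒¬Leaf branch (u , only) with w , vw , w≢u ← branch u = w≢u (only w vw)

  -- External private neighbours and the triples they form.

  Private : Subset n → Fin n → Fin n → Set
  Private S v x = Adj v x × x ∉ S × (∀ u → u ∈ S → Adj u x → u ≡ v)

  private? : ∀ S v x → Dec (Private S v x)
  private? S v x = adj? v x ×-dec ¬? (x ∈? S)
    ×-dec Fin.all? λ u → (u ∈? S) →-dec (adj? u x →-dec (u Fin.≟ v))

  TwoPrivate : Subset n → Fin n → Set
  TwoPrivate S v = ∃[ x ] ∃[ y ] Private S v x × Private S v y × x ≢ y

  twoPrivate? : ∀ S v → Dec (TwoPrivate S v)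
  twoPrivate? S v = Fin.any? λ x → Fin.any? λ y →
    private? S v x ×-dec private? S v y ×-dec ¬? (x Fin.≟ y)

  -- Each vertex of `S` forms a triple with two of its private neighbours. These triples are
  -- disjoint, since a private neighbour lies outside `S` and has only one neighbour in `S`.
  twoPrivate⇒3∣S∣≤n : ∀ S → (∀ {v} → v ∈ S → TwoPrivate S v) → ∣ S ∣ * 3 ≤ n
  twoPrivate⇒3∣S∣≤n S two = Fin.injective⇒≤ {f = uncurry pick ∘ split} λ {s} {t} eq →
    trans (sym (Fin.combine-remQuot {∣ S ∣} 3 s))
      (trans (cong (uncurry combine) (pick-injective (split s) (split t) eq))
        (Fin.combine-remQuot {∣ S ∣} 3 t))
    where
    split : Fin (∣ S ∣ * 3) → Fin ∣ S ∣ × Fin 3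
    split = remQuot {∣ S ∣} 3

    vertex : Fin ∣ S ∣ → Fin n
    vertex = enumerate S

    vertex∈S : ∀ i → vertex i ∈ S
    vertex∈S = enumerate-∈ S

    private₁ : ∀ i → Private S (vertex i) (proj₁ (two (vertex∈S i)))
    private₁ i = proj₁ (proj₂ (proj₂ (two (vertex∈S i))))

    private₂ : ∀ i → Private S (vertex i) (proj₁ (proj₂ (two (vertex∈S i))))
    private₂ i = proj₁ (proj₂ (proj₂ (proj₂ (two (vertex∈S i)))))

    pick : Fin ∣ S ∣ → Fin 3 → Fin n
    pick i zero             = vertex i
    pick i (suc zero)       = proj₁ (two (vertex∈S i))
    pick i (suc (suc zero)) = proj₁ (proj₂ (two (vertex∈S i)))

    Owned : Fin n → Fin n → Set
    Owned v x = x ≡ v ⊎ Private S v x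

    pick-owned : ∀ i j → Owned (vertex i) (pick i j)
    pick-owned i zero             = inj₁ refl
    pick-owned i (suc zero)       = inj₂ (private₁ i)
    pick-owned i (suc (suc zero)) = inj₂ (private₂ i)

    owner-unique : ∀ {u v x} → u ∈ S → v ∈ S → Owned u x → Owned v x → u ≡ v
    owner-unique _   _   (inj₁ refl)          (inj₁ refl)          = refl
    owner-unique u∈S _   (inj₁ refl)          (inj₂ (_ , x∉S , _)) = contradiction u∈S x∉S
    owner-unique _   v∈S (inj₂ (_ , x∉S , _)) (inj₁ refl)          = contradiction v∈S x∉S
    owner-unique u∈S _   (inj₂ (ux , _))      (inj₂ (_ , _ , only)) = only _ u∈S ux

    pick-injectiveʳ : ∀ i j k → pick i j ≡ pick i k → j ≡ k
    pick-injectiveʳ i zero zero _ = refl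
    pick-injectiveʳ i (suc zero) (suc zero) _ = refl
    pick-injectiveʳ i (suc (suc zero)) (suc (suc zero)) _ = refl
    pick-injectiveʳ i zero (suc zero) eq =
      contradiction (proj₁ (private₁ i)) (irrefl eq)
    pick-injectiveʳ i (suc zero) zero eq =
      contradiction (proj₁ (private₁ i)) (irrefl (sym eq))
    pick-injectiveʳ i zero (suc (suc zero)) eq =
      contradiction (proj₁ (private₂ i)) (irrefl eq)
    pick-injectiveʳ i (suc (suc zero)) zero eq =
      contradiction (proj₁ (private₂ i)) (irrefl (sym eq))
    pick-injectiveʳ i (suc zero) (suc (suc zero)) eq =
      contradiction eq (proj₂ (proj₂ (proj₂ (proj₂ (two (vertex∈S i))))))
    pick-injectiveʳ i (suc (suc zero)) (suc zero) eq =
      contradiction (sym eq) (proj₂ (proj₂ (proj₂ (proj₂ (two (vertex∈S i))))))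

    pick-injective : ∀ s t → uncurry pick s ≡ uncurry pick t → s ≡ t
    pick-injective (i , j) (k , l) eq
      with refl ← enumerate-injective S (owner-unique (vertex∈S i) (vertex∈S k)
                    (subst (Owned (vertex i)) eq (pick-owned i j)) (pick-owned k l)) =
      cong (i ,_) (pick-injectiveʳ i j l eq)

  -- Dropping and exchanging vertices.

  HasNeighbourIn : Subset n → Fin n → Set
  HasNeighbourIn S v = ∃[ u ] u ∈ S × Adj v u

  hasNeighbourIn? : ∀ S v → Dec (HasNeighbourIn S v)
  hasNeighbourIn? S v = Fin.any? λ u → u ∈? S ×-dec adj? v u

  isolated? : ∀ S v → Dec (v ∈ S × ¬ HasNeighbourIn S v)
  isolated? S v = v ∈? S ×-dec ¬? (hasNeighbourIn? S v)

  isolated : Subset n → Subset n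
  isolated S = ⟪ isolated? S ⟫

  nonprivate : ∀ {S v x} → Adj v x → ¬ Private S v x → x ∉ S → ∃[ u ] u ∈ S - v × Adj u x
  nonprivate {S} {v} {x} vx ¬priv x∉S
    with Fin.any? (λ u → u ∈? S - v ×-dec adj? u x)
  ... | yes found = found
  ... | no  none  = contradiction (vx , x∉S , λ u u∈S ux →
    decidable-stable (u Fin.≟ v) λ u≢v → none (u , x∈p∧x≢y⇒x∈p-y u∈S u≢v , ux)) ¬priv

  -- A set that dominates v and the neighbours of v not private to v lets v force its only
  -- private neighbour.
  spans-without : ∀ {S T v} → ¬ TwoPrivate S v → Spans S → S - v ⊆ T →
                  ∃[ u ] u ∈ T × Adj u v → Spans T
  spans-without {S} {T} {v} ¬two spans S-v⊆T (t , t∈T , tv) R covers closed =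
    -- It is enough that every closed set covering `T` also covers `S`.
    spans R covers′ closed
    where
    v∈R : v ∈ R
    v∈R = proj₂ (covers t∈T) tv

    old : ∀ {x} → Adj v x → ¬ Private S v x → x ∈ R
    old {x} vx ¬priv with x ∈? S
    ... | yes x∈S = proj₁ (covers (S-v⊆T (x∈p∧x≢y⇒x∈p-y x∈S λ x≡v → irrefl (sym x≡v) vx)))
    ... | no  x∉S with u , u∈ , ux ← nonprivate vx ¬priv x∉S = proj₂ (covers (S-v⊆T u∈)) ux

    Nv⊆R : ∀ {x} → Adj v x → x ∈ R
    Nv⊆R {x} vx with private? S v x
    ... | no  ¬priv = old vx ¬priv
    -- No neighbour other than `x` is private, so all of them are already in `R` and closedness at
    -- `v` yields `x`.
    ... | yes priv  = closed v∈R vx λ vy y≢x →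
      old vy λ priv′ → ¬two (_ , _ , priv′ , priv , y≢x)

    covers′ : Covers R S
    covers′ {w} w∈S with w Fin.≟ v
    ... | yes refl = v∈R , Nv⊆R
    ... | no  w≢v  = covers (S-v⊆T (x∈p∧x≢y⇒x∈p-y w∈S w≢v))

  AllBranching : Subset n → Set
  AllBranching S = ∀ {v} → v ∈ S → Branching v

  -- A vertex without two private neighbours can be dropped if it has a neighbour in S, and
  -- otherwise be exchanged for a neighbour u that is adjacent to S - v, which decreases the number
  -- of vertices isolated in S.
  improve : ∀ b c S → ∣ S ∣ ≤ b → ∣ isolated S ∣ ≤ c → AllBranching S → Spans S →
            ∃[ T ] Spans T × ∣ T ∣ * 3 ≤ n
  improve b c S ∣S∣≤b iso≤c branching spans
    with Fin.any? (λ v → v ∈? S ×-dec ¬? (twoPrivate? S v))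
  ... | no none = S , spans , twoPrivate⇒3∣S∣≤n S λ {v} v∈S →
    decidable-stable (twoPrivate? S v) λ ¬two → none (v , v∈S , ¬two)
  ... | yes (v , v∈S , ¬two) with hasNeighbourIn? S v
  improve zero c S ∣S∣≤b iso≤c branching spans | yes (v , v∈S , ¬two) | yes _ =
    contradiction (ℕ.≤-trans (x∈p⇒1≤∣p∣ v∈S) ∣S∣≤b) λ ()
  -- Dropping `v` may isolate other vertices, so the second bound is reset to the trivial `n`: the
  -- recursion is lexicographic in `b` and `c`.
  improve (suc b) c S ∣S∣≤b iso≤c branching spans | yes (v , v∈S , ¬two) | yes (u , u∈S , vu) =
    improve b n (S - v) (s≤s⁻¹ (ℕ.≤-trans (x∈p⇒∣p-x∣<∣p∣ v∈S) ∣S∣≤b)) (∣p∣≤n (isolated (S - v)))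
      (branching ∘ p─q⊆p S ⁅ v ⁆)
      (spans-without ¬two spans (λ x → x)
        (u , x∈p∧x≢y⇒x∈p-y u∈S (λ u≡v → irrefl (sym u≡v) vu) , symm vu))
  improve b zero S ∣S∣≤b iso≤c branching spans | yes (v , v∈S , ¬two) | no ¬nbr =
    contradiction (ℕ.≤-trans (x∈p⇒1≤∣p∣ (∈⟪⟫⁺ (isolated? S) (v∈S , ¬nbr))) iso≤c) λ ()
  improve b (suc c) S ∣S∣≤b iso≤c branching spans | yes (v , v∈S , ¬two) | no ¬nbr
    = improve b c T ∣T∣≤b (s≤s⁻¹ (ℕ.≤-trans iso< iso≤c)) branching′
        (spans-without ¬two spans S-v⊆T (u , u∈T , symm vu))
    where
    shared : ∃[ u ] Adj v u × ¬ Private S v u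
    -- `branching` gives two distinct neighbours of `v`, and at most one of them is private.
    shared with x , vx , _ ← branching v∈S v with private? S v x
    ... | no ¬priv = x , vx , ¬priv
    ... | yes priv with y , vy , y≢x ← branching v∈S x =
      y , vy , λ priv′ → ¬two (y , x , priv′ , priv , y≢x)

    u : Fin n
    u = proj₁ shared

    vu : Adj v u
    vu = proj₁ (proj₂ shared)

    nonprivate-vu : ∃[ t ] t ∈ S - v × Adj t u
    nonprivate-vu = nonprivate vu (proj₂ (proj₂ shared)) λ u∈S → ¬nbr (u , u∈S , vu)

    t : Fin n
    t = proj₁ nonprivate-vu

    t∈S-v : t ∈ S - v
    t∈S-v = proj₁ (proj₂ nonprivate-vu)

    tu : Adj t u
    tu = proj₂ (proj₂ nonprivate-vu)

    T : Subset n
    T = (S - v) ∪ ⁅ u ⁆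

    S-v⊆T : S - v ⊆ T
    S-v⊆T = p⊆p∪q ⁅ u ⁆

    u∈T : u ∈ T
    u∈T = q⊆p∪q (S - v) ⁅ u ⁆ (x∈⁅x⁆ u)

    ∈T⁻ : ∀ {x} → x ∈ T → x ∈ S - v ⊎ x ≡ u
    ∈T⁻ x∈T with x∈p∪q⁻ (S - v) ⁅ u ⁆ x∈T
    ... | inj₁ x∈  = inj₁ x∈
    ... | inj₂ x∈u = inj₂ (x∈⁅y⁆⇒x≡y u x∈u)

    ∣T∣≤b : ∣ T ∣ ≤ b
    ∣T∣≤b = ℕ.≤-trans (∣p∪⁅x⁆∣≤1+∣p∣ (S - v) u) (ℕ.≤-trans (x∈p⇒∣p-x∣<∣p∣ v∈S) ∣S∣≤b)

    v≢t : v ≢ t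
    v≢t v≡t = x∉p-x S v (subst (_∈ S - v) (sym v≡t) t∈S-v)

    -- The new member keeps `AllBranching` intact, as `v` and `t` are distinct neighbours of `u`.
    branching-u : Branching u
    branching-u w with v Fin.≟ w
    ... | no  v≢w  = v , symm vu , v≢w
    ... | yes refl = t , symm tu , ≢-sym v≢t

    branching′ : AllBranching T
    branching′ x∈T with ∈T⁻ x∈T
    ... | inj₁ x∈   = branching (p─q⊆p S ⁅ v ⁆ x∈)
    ... | inj₂ refl = branching-u

    v∉T : v ∉ T
    v∉T v∈T with ∈T⁻ v∈T
    ... | inj₁ v∈S-v = x∉p-x S v v∈S-v
    ... | inj₂ v≡u   = irrefl v≡u vu

    -- `u` is not isolated in `T` because of `t`. The other vertices of `T` could only have lost the
    -- neighbour `v`, which had no neighbour in `S`.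
    iso⊆ : isolated T ⊆ isolated S
    iso⊆ {x} x∈ with x∈T , ¬nbrT ← ∈⟪⟫⁻ (isolated? T) x∈ with ∈T⁻ x∈T
    ... | inj₂ refl = contradiction (t , S-v⊆T t∈S-v , symm tu) ¬nbrT
    ... | inj₁ x∈S-v = ∈⟪⟫⁺ (isolated? S) (p─q⊆p S ⁅ v ⁆ x∈S-v , ¬nbrS)
      where
      ¬nbrS : ¬ HasNeighbourIn S x
      ¬nbrS (w , w∈S , xw) with w Fin.≟ v
      ... | yes refl = ¬nbr (x , p─q⊆p S ⁅ v ⁆ x∈S-v , symm xw)
      ... | no  w≢v  = ¬nbrT (w , S-v⊆T (x∈p∧x≢y⇒x∈p-y w∈S w≢v) , xw)

    iso< : ∣ isolated T ∣ < ∣ isolated S ∣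
    iso< = p⊂q⇒∣p∣<∣q∣ (iso⊆ , v , ∈⟪⟫⁺ (isolated? S) (v∈S , ¬nbr)
                       , λ v∈ → v∉T (proj₁ (∈⟪⟫⁻ (isolated? T) v∈)))

  -- The bound `n / 3` for connected graphs.

  adj-invariant : ∀ (P : Fin n → Set) → (∀ {x y} → P x → Adj x y → P y) →
                  ∀ {x y} → P x → Star Adj x y → P y
  adj-invariant P step px ε        = px
  adj-invariant P step px (xy ◅ r) = adj-invariant P step (step px xy) r

  -- Otherwise `v` and `w` would have no neighbours but each other, and connectedness would leave no
  -- third vertex; `side` would then embed all vertices into `Fin 2`.
  leaf-neighbour-branching : 3 ≤ n → Connected G → ∀ {v w} → Leaf v → Adj v w → Branching w
  leaf-neighbour-branching 3≤n conn {v} {w} (a , only-a) vw =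
    ¬Leaf⇒Branching λ (b , only-b) → ℕ.<⇒≱ 3≤n (Fin.injective⇒≤ {f = side} (inj b only-b))
    where
    side : Fin n → Fin 2
    side x with x Fin.≟ v
    ... | yes _ = zero
    ... | no  _ = suc zero

    covered : ∀ {b} → (∀ y → Adj w y → y ≡ b) → ∀ x → x ≡ v ⊎ x ≡ w
    covered only-b x = adj-invariant (λ x → x ≡ v ⊎ x ≡ w)
      (λ { (inj₁ refl) xy → inj₂ (trans (only-a _ xy) (sym (only-a _ vw)))
         ; (inj₂ refl) xy → inj₁ (trans (only-b _ xy) (sym (only-b _ (symm vw)))) })
      (inj₁ refl) (conn v x)

    inj : ∀ b → (∀ y → Adj w y → y ≡ b) → Injective _≡_ _≡_ side
    inj b only-b {x} {y} eq with x Fin.≟ v | y Fin.≟ v | covered only-b x | covered only-b y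
    ... | yes p | yes q | _ | _ = trans p (sym q)
    ... | no  p | no  q | inj₁ p′ | _ = contradiction p′ p
    ... | no  p | no  q | inj₂ _  | inj₁ q′ = contradiction q′ q
    ... | no  p | no  q | inj₂ p′ | inj₂ q′ = trans p′ (sym q′)

  branchingVertices : Subset n
  branchingVertices = ⟪ (¬? ∘ leaf?) ⟫

  γP≤n/3 : 3 ≤ n → Connected G → γP G ≤ n / 3
  γP≤n/3 3≤n conn =
    -- The descent starts from all non-leaves, which span because the neighbour of a leaf is not a
    -- leaf.
    let T , spans , 3∣T∣≤n = improve n n branchingVertices
          (∣p∣≤n branchingVertices) (∣p∣≤n (isolated branchingVertices))
          (¬Leaf⇒Branching ∘ ∈⟪⟫⁻ (¬? ∘ leaf?)) all-spans
    in ℕ.≤-trans (γP≤ spans) (subst (_≤ n / 3) (m*n/n≡m ∣ T ∣ 3) (/-monoˡ-≤ 3 3∣T∣≤n))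
    where
    neighbour : ∀ {x y} → x ≢ y → Star Adj x y → ∃ (Adj x)
    neighbour x≢x ε        = contradiction refl x≢x
    neighbour _   (xy ◅ _) = _ , xy

    all-spans : Spans branchingVertices
    all-spans R covers closed x with leaf? x
    ... | no ¬leaf = proj₁ (covers (∈⟪⟫⁺ (¬? ∘ leaf?) ¬leaf))
    ... | yes leaf with y , x≢y ← ∃-distinct (ℕ.≤-trans (ℕ.n≤1+n 2) 3≤n) x
      with w , xw ← neighbour x≢y (conn x y) =
      proj₂ (covers (∈⟪⟫⁺ (¬? ∘ leaf?)
        (Branching⇒¬Leaf (leaf-neighbour-branching 3≤n conn leaf xw)))) (symm xw)

-- Spanning sets of complements and stars; twin leaves.

module _ {n} (G : Graph n) where
  open Graph G

  leaf-spans-complement : ∀ {v u w} → (∀ y → Adj v y → y ≡ u) → w ≢ u → ¬ Adj u w →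
                          Spans (complement G) ⁅ v ⁆
  leaf-spans-complement {v} {u} {w} only w≢u ¬uw R covers closed = everything
    where
    others : ∀ {x} → x ≢ u → x ∈ R
    others {x} x≢u with v Fin.≟ x
    ... | yes refl = proj₁ (covers (x∈⁅x⁆ v))
    ... | no  v≢x  = proj₂ (covers (x∈⁅x⁆ v)) (v≢x , x≢u ∘ only x)

    everything : ∀ x → x ∈ R
    everything x with x Fin.≟ u
    ... | no  x≢u  = others x≢u
    -- In the complement `w` is adjacent to `u`, and every other vertex is already in `R`, so `w`
    -- forces `u`.
    ... | yes refl = closed (others w≢u) (w≢u , ¬uw ∘ symm) λ _ → others

  Universal : Fin n → Set
  Universal u = ∀ {w} → w ≢ u → Adj u w

  universal-spans : ∀ {u} → Universal u → Spans G ⁅ u ⁆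
  universal-spans {u} univ R covers _ x with x Fin.≟ u
  ... | yes refl = proj₁ (covers (x∈⁅x⁆ u))
  ... | no  x≢u  = proj₂ (covers (x∈⁅x⁆ u)) (univ x≢u)

  -- An edge avoiding `u` would close a triangle with `u`.
  universal⇒independent : ¬ Cycle G → ∀ {u} → Universal u →
                          ∀ {a b} → a ≢ u → b ≢ u → ¬ Adj a b
  universal⇒independent acyclic {u} univ {a} {b} a≢u b≢u ab = acyclic record
    { first    = u
    ; rest     = a ∷ b ∷ []
    ; long     = ℕ.≤-refl
    ; distinct = (≢-sym a≢u ∷ ≢-sym b≢u ∷ []) ∷ ((λ a≡b → irrefl a≡b ab) ∷ []) ∷ [] ∷ []
    ; closed   = univ a≢u ∷ ab ∷ symm (univ b≢u) ∷ [-]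
    }

  -- In the complement the vertices other than `u` form a clique, dominated by `w`; `u` is taken
  -- into the set because it is isolated there when `G` is a star with centre `u`.
  star-complement-spans : ∀ {u w} → (∀ {a b} → a ≢ u → b ≢ u → ¬ Adj a b) → w ≢ u →
                          Spans (complement G) (⁅ u ⁆ ∪ ⁅ w ⁆)
  star-complement-spans {u} {w} indep w≢u R covers _ x with x Fin.≟ u | w Fin.≟ x
  ... | yes refl | _        = proj₁ (covers (p⊆p∪q ⁅ w ⁆ (x∈⁅x⁆ u)))
  ... | no _     | yes refl = proj₁ (covers (q⊆p∪q ⁅ u ⁆ ⁅ w ⁆ (x∈⁅x⁆ w)))
  ... | no x≢u   | no w≢x   =
    proj₂ (covers (q⊆p∪q ⁅ u ⁆ ⁅ w ⁆ (x∈⁅x⁆ w))) (w≢x , indep w≢u x≢u)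

  -- For empty `S` the set `⊥` would be closed and cover `S`, hence contain `x`.
  spans⇒nonempty : ∀ {S} → Fin n → Spans G S → 1 ≤ ∣ S ∣
  spans⇒nonempty {S} x spans with Fin.any? (_∈? S)
  ... | yes (_ , v∈S) = x∈p⇒1≤∣p∣ v∈S
  ... | no  none      = contradiction
    (spans ⊥ (λ v∈S → contradiction (_ , v∈S) none) (λ v∈⊥ → contradiction v∈⊥ ∉⊥) x) ∉⊥

  -- The pair `a`, `b` is a fort: only `h` could force one of them, but `h` sees both, so the set
  -- `R` of all other vertices is closed. It covers `S` as soon as `S` misses `h`, `a` and `b`.
  twin-leaves : ∀ {S h a b} → Adj h a → Adj h b → a ≢ b →
                (∀ {y} → Adj a y → y ≡ h) → (∀ {y} → Adj b y → y ≡ h) →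
                Spans G S → h ∈ S ⊎ a ∈ S ⊎ b ∈ S
  twin-leaves {S} {h} {a} {b} ha hb a≢b only-a only-b spans with h ∈? S | a ∈? S | b ∈? S
  ... | yes h∈S | _       | _       = inj₁ h∈S
  ... | no _    | yes a∈S | _       = inj₂ (inj₁ a∈S)
  ... | no _    | no _    | yes b∈S = inj₂ (inj₂ b∈S)
  ... | no h∉S  | no a∉S  | no b∉S  = contradiction refl (proj₁ (∈R⁻ (spans R covers closed a)))
    where
    R? : ∀ x → Dec (x ≢ a × x ≢ b)
    R? x = ¬? (x Fin.≟ a) ×-dec ¬? (x Fin.≟ b)

    R : Subset n
    R = ⟪ R? ⟫

    ∈R⁻ : ∀ {x} → x ∈ R → x ≢ a × x ≢ b
    ∈R⁻ = ∈⟪⟫⁻ R?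

    covers : Covers G R S
    covers v∈S = ∈⟪⟫⁺ R? ((λ { refl → a∉S v∈S }) , (λ { refl → b∉S v∈S }))
               , λ vy → ∈⟪⟫⁺ R?
                   ( (λ { refl → h∉S (subst (_∈ S) (only-a (symm vy)) v∈S) })
                   , (λ { refl → h∉S (subst (_∈ S) (only-b (symm vy)) v∈S) }) )

    closed : Closed G R
    closed {v} {x} v∈R vx others = ∈⟪⟫⁺ R?
      ( (λ { refl → proj₂ (∈R⁻ (others (subst (λ h → Adj h b) (sym (only-a (symm vx))) hb)
                                 (≢-sym a≢b))) refl })
      , (λ { refl → proj₁ (∈R⁻ (others (subst (λ h → Adj h a) (sym (only-b (symm vx))) ha)
                                 a≢b)) refl }) )

-- Paths as lists, and leaves of acyclic graphs.

module _ {A : Set} {R : A → A → Set} where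

  linked-prefix : ∀ xs {z zs} → Linked R (xs ++ z ∷ zs) → Linked R (xs ∷ʳ z)
  linked-prefix []           _        = [-]
  linked-prefix (x ∷ [])     (r ∷ _)  = r ∷ [-]
  linked-prefix (x ∷ y ∷ xs) (r ∷ rs) = r ∷ linked-prefix (y ∷ xs) rs

module _ {A : Set} where

  -- Cuts a path at `z` and puts `z` in front, the form in which `Cycle` lists its vertices.
  unique-rotate : ∀ xs {z : A} {zs} → Unique (xs ++ z ∷ zs) → Unique (z ∷ xs)
  unique-rotate []       _ = [] ∷ []
  unique-rotate (x ∷ xs) (x≢ ∷ u) with z≢xs ∷ uxs ← unique-rotate xs u
    with x≢z ∷ _ ← All.++⁻ʳ xs x≢ =
    (≢-sym x≢z ∷ z≢xs) ∷ All.++⁻ˡ xs x≢ ∷ uxs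

  unique-lookup-injective : ∀ {xs : List A} → Unique xs → Injective _≡_ _≡_ (lookup xs)
  unique-lookup-injective (_  ∷ _) {zero}  {zero}  _  = refl
  unique-lookup-injective (x≢ ∷ _) {zero}  {suc j} eq =
    contradiction eq (All.lookup x≢ (∈-lookup j))
  unique-lookup-injective (x≢ ∷ _) {suc i} {zero}  eq =
    contradiction (sym eq) (All.lookup x≢ (∈-lookup i))
  unique-lookup-injective (_  ∷ u) {suc i} {suc j} eq =
    cong suc (unique-lookup-injective u eq)

module _ {n} (G : Graph n) where
  open Graph G

  -- A path is extended at its head x until the new neighbour z already lies on it.
  extend : (∀ v → Branching G v) → ∀ k x y l → n < k + length (x ∷ y ∷ l) →
           Unique (x ∷ y ∷ l) → Linked Adj (x ∷ y ∷ l) → Cycle G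
  -- `k` is fuel: once it is spent, the path has more than `n` distinct vertices.
  extend branch zero x y l n< u _ =
    contradiction n< (ℕ.≤⇒≯ (Fin.injective⇒≤ (unique-lookup-injective u)))
  extend branch (suc k) x y l n< u path with z , xz , z≢y ← branch x y with Any.any? (z Fin.≟_) l
  ... | no z∉l = extend branch k z x (y ∷ l) (subst (n <_) (sym (ℕ.+-suc k _)) n<)
        (((λ z≡x → irrefl (sym z≡x) xz) ∷ z≢y ∷ All.¬Any⇒All¬ l z∉l) ∷ u) (symm xz ∷ path)
  -- The path is cut at `z`. As `z` differs from `x` and `y`, at least three vertices remain on the
  -- cycle.
  ... | yes z∈l with l₁ , l₂ , refl ← ∈-∃++ z∈l = record
    { first    = z
    ; rest     = x ∷ y ∷ l₁
    ; long     = s≤s (s≤s (s≤s z≤n))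
    ; distinct = unique-rotate (x ∷ y ∷ l₁) u
    ; closed   = symm xz ∷ linked-prefix (x ∷ y ∷ l₁) path
    }

  acyclic⇒leaf : ¬ Cycle G → Fin n → ∃ (Leaf G)
  acyclic⇒leaf acyclic v with Fin.any? (leaf? G)
  ... | yes found = found
  ... | no  none with branch ← (λ v → ¬Leaf⇒Branching G λ leaf → none (v , leaf))
    with w , vw , w≢v ← branch v v =
    contradiction
      (extend branch n v w [] (ℕ.m<m+n n (s≤s z≤n)) ((≢-sym w≢v ∷ []) ∷ [] ∷ []) (vw ∷ [-]))
      acyclic

-- Recognising stars as `K 1 m`.

module _ {m : ℕ} where

  K₁⁺ : ∀ {x y : Fin (suc m)} → x ≢ y → x ≡ zero ⊎ y ≡ zero → Graph.Adj (K 1 m) x y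
  K₁⁺ {zero}  {zero}  x≢y _ = contradiction refl x≢y
  K₁⁺ {zero}  {suc _} _   _ = λ ()
  K₁⁺ {suc _} {zero}  _   _ = λ ()
  K₁⁺ {suc _} {suc _} _   (inj₁ ())
  K₁⁺ {suc _} {suc _} _   (inj₂ ())

  K₁⁻ : ∀ {x y : Fin (suc m)} → Graph.Adj (K 1 m) x y → x ≢ y × (x ≡ zero ⊎ y ≡ zero)
  K₁⁻ {zero}  {zero}  xy = contradiction refl xy
  K₁⁻ {zero}  {suc _} _  = (λ ()) , inj₁ refl
  K₁⁻ {suc _} {zero}  _  = (λ ()) , inj₂ refl
  K₁⁻ {suc _} {suc _} xy = contradiction refl xy

-- Adjacency on both sides means being distinct with one endpoint the centre, so any bijection
-- matching the centres works; the transposition of `u` and `zero` is one.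
star≅K : ∀ {m} (G : Graph (suc m)) {u} → Universal G u →
         (∀ {a b} → a ≢ u → b ≢ u → ¬ Graph.Adj G a b) → G ≅ K 1 m
star≅K {m} G {u} univ indep = record
  { bijection = π
  ; preserves = λ a b → mk⇔ (forward a b) (backward a b)
  }
  where
  open Graph G
  π = transpose u zero
  open Inverse π using (to; from; strictlyInverseʳ)

  to-injective : ∀ a b → to a ≡ to b → a ≡ b
  to-injective a b eq =
    trans (sym (strictlyInverseʳ a)) (trans (cong from eq) (strictlyInverseʳ b))

  to-u : to u ≡ zero
  to-u rewrite dec-true (u Fin.≟ u) refl = refl

  to≡zero⇒≡u : ∀ a → to a ≡ zero → a ≡ u
  to≡zero⇒≡u a eq = to-injective a u (trans eq (sym to-u))

  forward : ∀ a b → Adj a b → Graph.Adj (K 1 m) (to a) (to b)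
  forward a b ab = K₁⁺ (λ eq → irrefl (to-injective a b eq) ab) (endpoint (a Fin.≟ u) (b Fin.≟ u))
    where
    endpoint : Dec (a ≡ u) → Dec (b ≡ u) → to a ≡ zero ⊎ to b ≡ zero
    endpoint (yes refl) _          = inj₁ to-u
    endpoint (no _)     (yes refl) = inj₂ to-u
    endpoint (no a≢u)   (no b≢u)   = contradiction ab (indep a≢u b≢u)

  backward : ∀ a b → Graph.Adj (K 1 m) (to a) (to b) → Adj a b
  backward a b toab with K₁⁻ toab
  ... | a≢b , inj₁ a≡0 with refl ← to≡zero⇒≡u a a≡0 =
    univ λ b≡u → a≢b (cong to (sym b≡u))
  ... | a≢b , inj₂ b≡0 with refl ← to≡zero⇒≡u b b≡0 =
    symm (univ λ a≡u → a≢b (cong to a≡u))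

-- A star of order 4 or 5 is one of the two excluded graphs. From order 6 on, `n / 3` is at least 2,
-- as the star case requires.
6≤order : ∀ n (G : Graph n) → 4 ≤ n → ∀ {u} → Universal G u →
          (∀ {a b} → a ≢ u → b ≢ u → ¬ Graph.Adj G a b) →
          ¬ (G ≅ K 1 3) → ¬ (G ≅ K 1 4) → 6 ≤ n
6≤order 1 _ (s≤s ())
6≤order 2 _ (s≤s (s≤s ()))
6≤order 3 _ (s≤s (s≤s (s≤s ())))
6≤order 4 G _ univ indep ≇K₁₃ _ = contradiction (star≅K G univ indep) ≇K₁₃
6≤order 5 G _ univ indep _ ≇K₁₄ = contradiction (star≅K G univ indep) ≇K₁₄
6≤order (suc (suc (suc (suc (suc (suc _)))))) _ _ _ _ _ _ =
  s≤s (s≤s (s≤s (s≤s (s≤s (s≤s z≤n)))))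

-- The upper bound for trees.

module _ {n} (G : Graph n) where
  open Graph G

  γP-complement≤1 : ∀ {v u w} → (∀ y → Adj v y → y ≡ u) → w ≢ u → ¬ Adj u w →
                    γP (complement G) ≤ 1
  γP-complement≤1 {v} only w≢u ¬uw = subst (γP (complement G) ≤_) (∣⁅x⁆∣≡1 v)
    (γP≤ (complement G) (leaf-spans-complement G only w≢u ¬uw))

  universal⇒γP≤1 : ∀ {u} → Universal G u → γP G ≤ 1
  universal⇒γP≤1 {u} univ = subst (γP G ≤_) (∣⁅x⁆∣≡1 u) (γP≤ G (universal-spans G univ))

  star⇒γP-complement≤2 : ∀ {u w} → (∀ {a b} → a ≢ u → b ≢ u → ¬ Adj a b) → w ≢ u →
                         γP (complement G) ≤ 2
  star⇒γP-complement≤2 {u} {w} indep w≢u =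
    ℕ.≤-trans (γP≤ (complement G) (star-complement-spans G indep w≢u))
      (subst (λ k → ∣ ⁅ u ⁆ ∪ ⁅ w ⁆ ∣ ≤ suc k) (∣⁅x⁆∣≡1 u) (∣p∪⁅x⁆∣≤1+∣p∣ ⁅ u ⁆ w))

-- The case distinctions take explicit arguments, since with-abstraction would normalise γP.
γP-product≤n/3 : ∀ n (G : Graph n) → 4 ≤ n → IsTree G → ¬ (G ≅ K 1 3) → ¬ (G ≅ K 1 4) →
                 γP G * γP (complement G) ≤ n / 3
γP-product≤n/3 n G 4≤n (conn , acyclic) ≇K₁₃ ≇K₁₄ =
  byLeaf (acyclic⇒leaf G acyclic (fromℕ< (ℕ.≤-trans (s≤s z≤n) 4≤n)))
  where
  open Graph G

  3≤n : 3 ≤ n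
  3≤n = ℕ.≤-trans (ℕ.n≤1+n 3) 4≤n

  2≤n : 2 ≤ n
  2≤n = ℕ.≤-trans (ℕ.n≤1+n 2) 3≤n

  byUniversality : ∀ {v u} → (∀ y → Adj v y → y ≡ u) → Dec (∃[ w ] w ≢ u × ¬ Adj u w) →
                   γP G * γP (complement G) ≤ n / 3
  byUniversality only (yes (w , w≢u , ¬uw)) =
    ℕ.≤-trans (ℕ.*-mono-≤ (γP≤n/3 G 3≤n conn) (γP-complement≤1 G only w≢u ¬uw))
      (ℕ.≤-reflexive (ℕ.*-identityʳ (n / 3)))
  byUniversality {v} {u} _ (no none) =
    -- The product is at most `1 * 2`, which evaluates to the same number as `6 / 3`.
    ℕ.≤-trans (ℕ.*-mono-≤ (universal⇒γP≤1 G univ) (star⇒γP-complement≤2 G indep (≢-sym u≢w)))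
      (/-monoˡ-≤ 3 (6≤order n G 4≤n univ indep ≇K₁₃ ≇K₁₄))
    where
    univ : Universal G u
    univ {w} w≢u = decidable-stable (adj? u w) λ ¬uw → none (w , w≢u , ¬uw)

    indep : ∀ {a b} → a ≢ u → b ≢ u → ¬ Adj a b
    indep = universal⇒independent G acyclic univ

    u≢w : u ≢ proj₁ (∃-distinct 2≤n u)
    u≢w = proj₂ (∃-distinct 2≤n u)

  byLeaf : ∃ (Leaf G) → γP G * γP (complement G) ≤ n / 3
  byLeaf (v , u , only) =
    byUniversality only (Fin.any? λ w → ¬? (w Fin.≟ u) ×-dec ¬? (adj? u w))

-- Forests given by a parent function, and the hub trees.

module ParentGraph {n} (parent : Fin n → Fin n) (rank : Fin n → ℕ)
                   (parent-rank : ∀ v → parent v ≡ v ⊎ rank (parent v) < rank v) where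

  graph : Graph n
  graph = record
    { Adj    = λ u v → u ≢ v × (parent u ≡ v ⊎ parent v ≡ u)
    ; adj?   = λ u v → ¬? (u Fin.≟ v) ×-dec ((parent u Fin.≟ v) ⊎-dec (parent v Fin.≟ u))
    ; symm   = λ (u≢v , e) → ≢-sym u≢v , swap e
    ; irrefl = λ u≡v (u≢v , _) → u≢v u≡v
    }

  open Graph graph

  toParent : ∀ v → Star Adj v (parent v)
  toParent v with v Fin.≟ parent v
  ... | yes v≡p = subst (Star Adj v) v≡p ε
  ... | no  v≢p = (v≢p , inj₁ refl) ◅ ε

  infix 4 _◁_
  -- Edges oriented towards the parent. A vertex has at most one outgoing edge, and rank drops along
  -- it.
  _◁_ : Fin n → Fin n → Set
  u ◁ v = parent u ≡ v × rank v < rank u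

  parent⇒◁ : ∀ {u v} → u ≢ v → parent u ≡ v → u ◁ v
  parent⇒◁ {u} u≢v refl with parent-rank u
  ... | inj₁ p≡u = contradiction (sym p≡u) u≢v
  ... | inj₂ p<u = refl , p<u

  orient : ∀ {u v} → Adj u v → u ◁ v ⊎ v ◁ u
  orient (u≢v , inj₁ e) = inj₁ (parent⇒◁ u≢v e)
  orient (u≢v , inj₂ e) = inj₂ (parent⇒◁ (≢-sym u≢v) e)

  ◁-functional : ∀ {u v w} → u ◁ v → u ◁ w → v ≡ w
  ◁-functional (e , _) (e′ , _) = trans (sym e) e′

  -- A path that has stepped from `a` down to its child `b` cannot turn upwards, as the only parent
  -- of `b` is already used. Ranks therefore increase up to `z`, which is entered from its parent.
  descend : ∀ {a b} l {z} → b ◁ a → Unique (a ∷ b ∷ l ∷ʳ z) → Linked Adj (b ∷ l ∷ʳ z) →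
            rank b < rank z × ∃[ w ] w ∈ₗ b ∷ l × z ◁ w
  descend [] ba ((_ ∷ a≢z ∷ _) ∷ _) (bz ∷ _) with orient bz
  ... | inj₁ b◁z = contradiction (◁-functional ba b◁z) a≢z
  ... | inj₂ z◁b = proj₂ z◁b , _ , here refl , z◁b
  descend (c ∷ l) ba ((_ ∷ a≢c ∷ _) ∷ u) (bc ∷ path) with orient bc
  ... | inj₁ b◁c = contradiction (◁-functional ba b◁c) a≢c
  ... | inj₂ c◁b with c<z , w , w∈ , z◁w ← descend l c◁b u path =
    ℕ.<-trans (proj₂ c◁b) c<z , w , there w∈ , z◁w

  -- Either the path goes up all the way, or it turns down once and `descend` applies from there.
  climb : ∀ {a} l {z} → Unique (a ∷ l ∷ʳ z) → Linked Adj (a ∷ l ∷ʳ z) →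
          rank z < rank a ⊎ ∃[ w ] w ∈ₗ a ∷ l × z ◁ w
  climb [] _ (az ∷ _) with orient az
  ... | inj₁ a◁z = inj₁ (proj₂ a◁z)
  ... | inj₂ z◁a = inj₂ (_ , here refl , z◁a)
  climb (b ∷ l) u@(_ ∷ u′) (ab ∷ path) with orient ab
  ... | inj₂ b◁a with _ , w , w∈ , z◁w ← descend l b◁a u path = inj₂ (w , there w∈ , z◁w)
  ... | inj₁ a◁b with climb l u′ path
  ...   | inj₁ z<b            = inj₁ (ℕ.<-trans z<b (proj₂ a◁b))
  ...   | inj₂ (w , w∈ , z◁w) = inj₂ (w , there w∈ , z◁w)

  -- If `x` is the parent of `z`, the way back to `z` either enters it from a second parent or only
  -- climbs, which contradicts the ranks. If `z` is the parent of `x`, the cycle descends throughout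
  -- and cannot return to the rank of `z`.
  acyclic : ¬ Cycle graph
  acyclic record { rest = [] ; long = s≤s () }
  acyclic record { rest = _ ∷ [] ; long = s≤s (s≤s ()) }
  acyclic record { first = z ; rest = x ∷ y ∷ r ; distinct = z≢ ∷ (x≢ ∷ uy)
                 ; closed = zx ∷ xy ∷ path } = go (orient zx) (orient xy)
    where
    u : Unique (x ∷ y ∷ r ∷ʳ z)
    u = AllPairs.++⁺ (x≢ ∷ uy) ([] ∷ []) (All.map (λ z≢ → ≢-sym z≢ ∷ []) z≢)

    u′ : Unique (y ∷ r ∷ʳ z)
    u′ with _ ∷ u′ ← u = u′

    not-back : ∀ {w} → w ∈ₗ y ∷ r → z ◁ w → ¬ z ◁ x
    not-back w∈ z◁w z◁x = All.lookup x≢ w∈ (◁-functional z◁x z◁w)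

    go : z ◁ x ⊎ x ◁ z → x ◁ y ⊎ y ◁ x → Empty.⊥
    go (inj₁ z◁x) (inj₁ x◁y) with climb r u′ path
    ... | inj₁ z<y            = ℕ.<-asym z<y (ℕ.<-trans (proj₂ x◁y) (proj₂ z◁x))
    ... | inj₂ (_ , w∈ , z◁w) = not-back w∈ z◁w z◁x
    go (inj₁ z◁x) (inj₂ y◁x) with _ , _ , w∈ , z◁w ← descend r y◁x u path =
      not-back w∈ z◁w z◁x
    go (inj₂ x◁z) (inj₁ x◁y) = All.lookup z≢ (there (here refl)) (◁-functional x◁z x◁y)
    go (inj₂ x◁z) (inj₂ y◁x) with y<z , _ ← descend r y◁x u path =
      ℕ.<-asym y<z (ℕ.<-trans (proj₂ x◁z) (proj₂ y◁x))

-- Vertex (i , 0) is the i-th hub, with leaves (i , 1) and (i , 2); the hubs form a star around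
-- hub 0.
module HubTree (k : ℕ) where

  coords : Fin (suc k * 3) → Fin (suc k) × Fin 3
  coords = remQuot {suc k} 3

  up : Fin (suc k) × Fin 3 → Fin (suc k) × Fin 3
  up (i , zero)  = zero , zero
  up (i , suc _) = i , zero

  depth : Fin (suc k) × Fin 3 → ℕ
  depth (zero  , zero)  = 0
  depth (suc _ , zero)  = 1
  depth (zero  , suc _) = 1
  depth (suc _ , suc _) = 2

  up-depth : ∀ c → up c ≡ c ⊎ depth (up c) < depth c
  up-depth (zero  , zero)  = inj₁ refl
  up-depth (suc _ , zero)  = inj₂ (s≤s z≤n)
  up-depth (zero  , suc _) = inj₂ (s≤s z≤n)
  up-depth (suc _ , suc _) = inj₂ (s≤s (s≤s z≤n))

  up-up : ∀ c → up (up c) ≡ (zero , zero)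
  up-up (_ , zero)  = refl
  up-up (_ , suc _) = refl

  up≢leaf : ∀ c {i j} → up c ≢ (i , suc j)
  up≢leaf (_ , zero)  ()
  up≢leaf (_ , suc _) ()

  parent : Fin (suc k * 3) → Fin (suc k * 3)
  parent v = uncurry combine (up (coords v))

  coords-parent : ∀ v → coords (parent v) ≡ up (coords v)
  coords-parent v = Fin.remQuot-combine _ _

  parent-combine : ∀ i j → parent (combine i j) ≡ uncurry combine (up (i , j))
  parent-combine i j = cong (uncurry combine ∘ up) (Fin.remQuot-combine i j)

  parent-rank : ∀ v → parent v ≡ v ⊎ depth (coords (parent v)) < depth (coords v)
  parent-rank v with up-depth (coords v)
  ... | inj₁ eq = inj₁ (trans (cong (uncurry combine) eq) (Fin.combine-remQuot {suc k} 3 v))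
  ... | inj₂ lt = inj₂ (subst (λ c → depth c < depth (coords v)) (sym (coords-parent v)) lt)

  open ParentGraph parent (depth ∘ coords) parent-rank public
  open Graph graph

  root : Fin (suc k * 3)
  root = combine {suc k} {3} zero zero

  -- No vertex is deeper than two, so the parent of the parent is always the root.
  toRoot : ∀ v → Star Adj v root
  toRoot v = toParent v ◅◅ subst (Star Adj (parent v)) parent-parent (toParent (parent v))
    where
    parent-parent : parent (parent v) ≡ root
    parent-parent = cong (uncurry combine)
      (trans (cong up (coords-parent v)) (up-up (coords v)))

  isTree : IsTree graph
  isTree = (λ u v → toRoot u ◅◅ reverse symm (toRoot v)) , acyclic

  hub : Fin (suc k) → Fin (suc k * 3)
  hub i = combine i zero

  leaf : Fin (suc k) → Fin 2 → Fin (suc k * 3)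
  leaf i j = combine i (suc j)

  hub-leaf : ∀ i j → Adj (hub i) (leaf i j)
  hub-leaf i j = (λ eq → contradiction (Fin.combine-injectiveʳ i zero i (suc j) eq) λ ())
               , inj₂ (parent-combine i (suc j))

  leaf-only : ∀ i j {y} → Adj (leaf i j) y → y ≡ hub i
  leaf-only i j     (_ , inj₁ eq) = trans (sym eq) (parent-combine i (suc j))
  leaf-only i j {y} (_ , inj₂ eq) = contradiction
    (trans (sym (coords-parent y)) (trans (cong coords eq) (Fin.remQuot-combine i (suc j))))
    (up≢leaf (coords y))

  meets-block : ∀ {S} → Spans graph S → ∀ i → ∃[ j ] combine i j ∈ S
  meets-block spans i
    with twin-leaves graph (hub-leaf i zero) (hub-leaf i (suc zero)) leaves-distinct
           (leaf-only i zero) (leaf-only i (suc zero)) spans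
    where
    leaves-distinct : leaf i zero ≢ leaf i (suc zero)
    leaves-distinct eq = contradiction
      (Fin.combine-injectiveʳ i (suc zero) i (suc (suc zero)) eq) λ ()
  ... | inj₁ h∈S        = _ , h∈S
  ... | inj₂ (inj₁ a∈S) = _ , a∈S
  ... | inj₂ (inj₂ b∈S) = _ , b∈S

  -- The blocks are disjoint, so choosing one member of `S` in each is injective.
  spans⇒k<∣S∣ : ∀ S → Spans graph S → suc k ≤ ∣ S ∣
  spans⇒k<∣S∣ S spans = injection⇒≤∣p∣ {p = S} {f = λ i → combine i (proj₁ (meets-block spans i))}
    (λ {i} {i′} → Fin.combine-injectiveˡ i _ i′ _)
    (λ i → proj₂ (meets-block spans i))

-- Sharpness for arbitrarily large order.

≅⇒≤ : ∀ {m n} {G : Graph m} {H : Graph n} → G ≅ H → m ≤ n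
≅⇒≤ iso = Fin.injective⇒≤ λ eq →
  trans (sym (strictlyInverseʳ _)) (trans (cong from eq) (strictlyInverseʳ _))
  where open Inverse (_≅_.bijection iso) using (from; strictlyInverseʳ)

-- Stated for an arbitrary G: comparing types that mention γP of a concrete graph unfolds γP.
γP-product≡n/3 : ∀ {m k} (G : Graph (k * 3)) → m ≤ k → 2 ≤ k → IsTree G →
                 (∀ {S} → Spans G S → k ≤ ∣ S ∣) →
                 ∃[ n ] ∃[ G ] m ≤ n × 4 ≤ n × IsTree {n} G × ¬ (G ≅ K 1 3) × ¬ (G ≅ K 1 4) ×
                   γP G * γP (complement G) ≡ n / 3
γP-product≡n/3 {m} {k} G m≤k 2≤k tree bound =
  k * 3 , G , ℕ.≤-trans m≤k (ℕ.m≤m*n k 3) , 4≤n , tree , ≇K₁₃ , ≇K₁₄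
  , ℕ.≤-antisym (γP-product≤n/3 _ G 4≤n tree ≇K₁₃ ≇K₁₄)
      -- The lower bound is `k * 1`, equal to `k * 3 / 3`; the factor 1 is there because no empty
      -- set spans the complement.
      (subst (_≤ γP G * γP (complement G)) (trans (ℕ.*-identityʳ k) (sym (m*n/n≡m k 3)))
        (ℕ.*-mono-≤ (≤γP G bound) (≤γP (complement G) (spans⇒nonempty (complement G) vertex))))
  where
  6≤n : 6 ≤ k * 3
  6≤n = ℕ.*-monoˡ-≤ 3 2≤k

  4≤n : 4 ≤ k * 3
  4≤n = ℕ.≤-trans (s≤s (s≤s (s≤s (s≤s z≤n)))) 6≤n

  vertex : Fin (k * 3)
  vertex = fromℕ< (ℕ.≤-trans (s≤s z≤n) 4≤n)

  ≇K₁₃ : ¬ (G ≅ K 1 3)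
  ≇K₁₃ iso with s≤s (s≤s (s≤s (s≤s ()))) ← ℕ.≤-trans 6≤n (≅⇒≤ iso)

  ≇K₁₄ : ¬ (G ≅ K 1 4)
  ≇K₁₄ iso with s≤s (s≤s (s≤s (s≤s (s≤s ())))) ← ℕ.≤-trans 6≤n (≅⇒≤ iso)

proposition4p8 : (∀ n (G : Graph n) → 4 ≤ n → IsTree G → ¬ (G ≅ K 1 3) → ¬ (G ≅ K 1 4) →
    γP G * γP (complement G) ≤ n / 3)
    ×
    (∀ m → ∃[ n ] ∃[ G ] m ≤ n × 4 ≤ n × IsTree {n} G × ¬ (G ≅ K 1 3) × ¬ (G ≅ K 1 4) ×
    γP G * γP (complement G) ≡ n / 3)
proposition4p8 = γP-product≤n/3 , λ m →
  -- This tree has `2 + m` hubs: at least `m`, and at least two, so that its order is at least 6 and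
  -- both excluded stars are too small.
  let open HubTree (suc m) in
  γP-product≡n/3 graph (ℕ.m≤n+m m 2) (s≤s (s≤s z≤n)) isTree λ {S} → spans⇒k<∣S∣ S
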